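{- For real $y\ge 2$ we have $$ \mathcal{S}_y = \bigcap_{i\ge 0} \mathcal{D}_{i,y}= \bigcap_{i\ge 0} \mathcal{D}^*_{i,y} . $$
   Context: $\mathbb{N}=\{1,2,\ldots\}$. $\mathcal{S}_y$ is the set of natural numbers all of whose prime factors are $\le y$. A finite increasing sequence of natural numbers is called $y$-dense if the ratios of consecutive terms are all $\le y$. Define $\mathcal{D}_{0,y}=\mathbb{N}$. For $i\ge 1$, $n\in \mathcal{D}_{i,y}$ if and only if the increasing sequence $\{d: d|n,\ d\in \mathcal{D}_{i-1,y}\}$ is a $y$-dense sequence containing $1$ and $n$. Define $\mathcal{D}^*_{0,y}=\mathbb{N}$. For $i\ge 1$, $n\in \mathcal{D}^*_{i,y}$ if and only if for each $j$ with $0\le j \le i-1$, the increasing sequence $\{d: d|n,\ d\in \mathcal{D}^*_{j,y} \text{ and } n/d \in \mathcal{D}^*_{i-1-j,y} \}$ is a $y$-dense sequence containing $1$ and $n$. -}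

module Defs where

open import Data.Integer.Base using (+_)
open import Data.List.Base using (List)
open import Data.List.Membership.Propositional using () renaming (_∈_ to _∈ˡ_)
open import Data.List.Relation.Unary.Linked using (Linked)
open import Data.Nat.Base as ℕ using (ℕ; zero; suc; NonZero; _∸_; s≤s)
open import Data.Nat.Divisibility using (_∣_; quotient)
open import Data.Nat.Induction using (<-Rec; <-rec)
open import Data.Nat.Primality using (Prime)
open import Data.Nat.Properties using (m∸n≤m)
open import Data.Product.Base using (Σ-syntax; ∃-syntax; _×_; _,_)
open import Data.Rational.Base as ℚ using (ℚ; 0ℚ; 1ℚ; _/_)
import Data.Rational.Properties as ℚₚ
open import Data.Sum.Base using (_⊎_; inj₁; inj₂)
open import Function.Bundles using (_⇔_; mk⇔)
open import Level using (0ℓ)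
open import Relation.Binary.PropositionalEquality.Core using (subst)
open import Relation.Nullary.Decidable.Core using (yes; no)
open import Relation.Nullary.Negation.Core using (¬_)
open import Relation.Unary using (Pred; _∈_; _⊆_; Satisfiable)

-- Real numbers as (two-sided, located) Dedekind cuts.

record ℝ : Set₁ where
  field
    lower upper     : Pred ℚ 0ℓ
    lower-inhabited : Satisfiable lower
    upper-inhabited : Satisfiable upper
    lower-rounded   : ∀ q → q ∈ lower ⇔ (∃[ r ] q ℚ.< r × r ∈ lower)
    upper-rounded   : ∀ r → r ∈ upper ⇔ (∃[ q ] q ℚ.< r × q ∈ upper)
    disjoint        : ∀ q → ¬ (q ∈ lower × q ∈ upper)
    located         : ∀ {q r} → q ℚ.< r → q ∈ lower ⊎ r ∈ upper

open ℝ public using (lower)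

infix 4 _≤_

_≤_ : ℝ → ℝ → Set
x ≤ y = lower x ⊆ lower y

fromℚ : ℚ → ℝ
fromℚ x = record
  { lower           = ℚ._< x
  ; upper           = x ℚ.<_
  ; lower-inhabited = x ℚ.- 1ℚ , subst (x ℚ.- 1ℚ ℚ.<_) (ℚₚ.+-identityʳ x)
                                    (ℚₚ.+-monoʳ-< x (ℚₚ.negative⁻¹ (ℚ.- 1ℚ)))
  ; upper-inhabited = x ℚ.+ 1ℚ , subst (ℚ._< x ℚ.+ 1ℚ) (ℚₚ.+-identityʳ x)
                                    (ℚₚ.+-monoʳ-< x (ℚₚ.positive⁻¹ 1ℚ))
  ; lower-rounded   = λ _ → mk⇔ ℚₚ.<-dense λ (_ , q<r , r<x) → ℚₚ.<-trans q<r r<x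
  ; upper-rounded   = λ _ → mk⇔ (λ x<r → let q , x<q , q<r = ℚₚ.<-dense x<r in q , q<r , x<q)
                                λ (_ , q<r , x<q) → ℚₚ.<-trans x<q q<r
  ; disjoint        = λ _ (q<x , x<q) → ℚₚ.<-asym q<x x<q
  ; located         = λ {q} → located′ {q}
  }
  where
  located′ : ∀ {q r} → q ℚ.< r → q ℚ.< x ⊎ x ℚ.< r
  located′ {q} q<r with q ℚₚ.<? x
  ... | yes q<x = inj₁ q<x
  ... | no  q≮x = inj₂ (ℚₚ.≤-<-trans (ℚₚ.≮⇒≥ q≮x) q<r)

fromℕ : ℕ → ℝ
fromℕ n = fromℚ (+ n / 1)

-- The natural numbers of the theory start at 1, so its sets of natural numbers
-- are the predicates on ℕ below, all of which entail NonZero.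

Smooth : ℝ → Pred ℕ 0ℓ
Smooth y n = NonZero n × (∀ p → Prime p → p ∣ n → fromℕ p ≤ y)

-- The instance argument only serves to form the quotient e / d; the lists that
-- matter consist of divisors of nonzero numbers.

Dense : ℝ → Pred (List ℕ) 0ℓ
Dense y = Linked λ d e → .{{_ : NonZero d}} → fromℚ (+ e / d) ≤ y

-- A strictly increasing list is determined by its set of entries, so ds is
-- *the* increasing sequence of the elements of A.

DenseFrom1To : ℕ → ℝ → Pred ℕ 0ℓ → Set
DenseFrom1To n y A =
  Σ[ ds ∈ List ℕ ]
    Linked ℕ._<_ ds × (∀ d → d ∈ˡ ds ⇔ d ∈ A) × Dense y ds × 1 ∈ˡ ds × n ∈ˡ ds

D : ℝ → ℕ → Pred ℕ 0ℓ
D y zero    n = NonZero n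
D y (suc i) n = NonZero n × DenseFrom1To n y (λ d → d ∣ n × d ∈ D y i)

-- In stage suc i the two indices are j and (suc i) - 1 - j = i ∸ j; for d ∣ n
-- with n nonzero, quotient d∣n is n / d.

D*-step : ℝ → ∀ i → <-Rec (λ _ → Pred ℕ 0ℓ) i → Pred ℕ 0ℓ
D*-step y zero    rec n = NonZero n
D*-step y (suc i) rec n =
  NonZero n ×
  (∀ j (j≤i : j ℕ.≤ i) →
    DenseFrom1To n y λ d →
      Σ[ d∣n ∈ d ∣ n ] d ∈ rec (s≤s j≤i) × quotient d∣n ∈ rec (s≤s (m∸n≤m i j)))

D* : ℝ → ℕ → Pred ℕ 0ℓ
D* y = <-rec (λ _ → Pred ℕ 0ℓ) (D*-step y)

{-# OPTIONS --safe #-}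

-- If n is y-smooth and d is a proper divisor of n, then d p divides n for some
-- prime p ≤ y, so the divisor following d is at most y d.  Since divisors of
-- smooth numbers are smooth, by induction all divisors take part in every stage
-- of either hierarchy.  Conversely, let p > y be prime.  If n is a multiple of p
-- whose chain of divisors in stage i is y-dense from 1 to n, take consecutive
-- d < e in the chain with p ∤ d and p ∣ e.  Then e ≤ y d < p d ≤ n, so n exceeds
-- some multiple of p in stage i.  Hence the multiples of p in stage i are > i,
-- and none lies in every stage.

module Submission where

open import Defs
open import Data.Integer.Base as ℤ using (+_)
import Data.Integer.Properties as ℤₚ
open import Data.List.Base using (List; []; _∷_; filter; upTo)
open import Data.List.Membership.Propositional using (lose) renaming (_∈_ to _∈ˡ_)
open import Data.List.Membership.Propositional.Properties
  using (∈-filter⁺; ∈-filter⁻; ∈-upTo⁺)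
open import Data.List.Relation.Unary.All as All using (All)
open import Data.List.Relation.Unary.Any using (Any; here; there)
open import Data.List.Relation.Unary.Linked as Linked using (Linked; []; [-]; _∷_)
import Data.List.Relation.Unary.Linked.Properties as Linkedₚ
open import Data.Nat.Base as ℕ
  using (ℕ; zero; suc; NonZero; NonTrivial; _*_; _<_; _∸_; s≤s; n>1⇒nonTrivial)
open import Data.Nat.Divisibility
open import Data.Nat.Induction using (Acc; acc; <-wellFounded)
open import Data.Nat.ListAction using (product)
open import Data.Nat.Primality using (Prime; euclidsLemma; prime⇒nonTrivial)
open import Data.Nat.Primality.Factorisation using (factorise; module PrimeFactorisation)
open import Data.Nat.Properties
open import Data.Product.Base using (∃-syntax; ∃₂; _×_; _,_; proj₁; proj₂)
open import Data.Rational.Base as ℚ using (_/_; toℚᵘ)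
import Data.Rational.Properties as ℚₚ
open import Data.Rational.Unnormalised.Base as ℚᵘ using (mkℚᵘ)
import Data.Rational.Unnormalised.Properties as ℚᵘₚ
open import Data.Sum.Base using (inj₁; inj₂)
open import Function.Base using (_∘_; id)
open import Function.Bundles using (_⇔_; mk⇔; module Equivalence)
open import Induction.WellFounded using (module Some)
open import Level using (0ℓ)
open import Relation.Binary.Core using (Rel)
open import Relation.Binary.PropositionalEquality
open import Relation.Nullary.Decidable.Core using (yes; no)
open import Relation.Nullary.Negation.Core using (¬_; contradiction)
open import Relation.Unary using (Pred; Decidable; _∈_; _⊆_; _≐_; ⋂)

private
  variable
    A : Set
    P : Pred A 0ℓ
    R : Rel A 0ℓ

module _ (y : ℝ) where
  open ℝ y using (upper; disjoint; located)

  -- Locatedness at some s < r < q puts s in the lower cut or r in the upper one, and the hypothesis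
  -- refutes the latter. So an inequality with y can be proved by refutation, without deciding the
  -- order on `ℝ`.
  ≤-via-upper : ∀ q → (∀ {r} → r ∈ upper → ¬ r ℚ.< q) → fromℚ q ≤ y
  ≤-via-upper q q≤upper {s} s<q with ℚₚ.<-dense s<q
  ... | r , s<r , r<q with located s<r
  ...   | inj₁ s∈lower = s∈lower
  ...   | inj₂ r∈upper = contradiction r<q (q≤upper r∈upper)

  ≤⇒≤upper : ∀ {q r} → fromℚ q ≤ y → r ∈ upper → q ℚ.≤ r
  ≤⇒≤upper q≤y r∈upper = ℚₚ.≮⇒≥ λ r<q → disjoint _ (q≤y r<q , r∈upper)

  ≤-fromℚ-≤ : ∀ {q r} → q ℚ.≤ r → fromℚ r ≤ y → fromℚ q ≤ y
  ≤-fromℚ-≤ q≤r r≤y s<q = r≤y (ℚₚ.<-≤-trans s<q q≤r)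

*≤*⇒/≤/ : ∀ a b c d .{{_ : NonZero b}} .{{_ : NonZero d}} →
          a * d ℕ.≤ c * b → (+ a / b) ℚ.≤ (+ c / d)
*≤*⇒/≤/ a (suc b) c (suc d) ad≤cb = ℚₚ.toℚᵘ-cancel-≤ (begin
  toℚᵘ (+ a / suc b)  ≃⟨ ℚₚ.toℚᵘ-fromℚᵘ (mkℚᵘ (+ a) b) ⟩
  mkℚᵘ (+ a) b        ≤⟨ ℚᵘ.*≤* (subst₂ ℤ._≤_ (ℤₚ.pos-* a (suc d)) (ℤₚ.pos-* c (suc b)) (ℤ.+≤+ ad≤cb)) ⟩
  mkℚᵘ (+ c) d        ≃⟨ ℚₚ.toℚᵘ-fromℚᵘ (mkℚᵘ (+ c) d) ⟨
  toℚᵘ (+ c / suc d)  ∎)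
  where open ℚᵘₚ.≤-Reasoning

head-least : ∀ {x xs a} → Linked _<_ (x ∷ xs) → a ∈ˡ x ∷ xs → x ℕ.≤ a
head-least sorted = All.lookup (Linkedₚ.Linked⇒All ≤-trans ≤-refl (Linked.map <⇒≤ sorted))

-- Turns adjacency into minimality: a divisor of n above d, however found, then bounds the divisor
-- that follows d.
successors-least : ∀ {xs} → Linked _<_ xs →
  Linked (λ d e → d ∈ˡ xs × e ∈ˡ xs × d < e × (∀ {z} → z ∈ˡ xs → d < z → e ℕ.≤ z)) xs
successors-least []  = []
successors-least [-] = [-]
successors-least {x ∷ y ∷ xs} (x<y ∷ sorted) =
  (here refl , there (here refl) , x<y , λ where
    (here refl) x<x → contradiction x<x (<-irrefl refl)
    (there z∈)  _   → head-least sorted z∈) ∷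
  Linked.map
    (λ (d∈ , e∈ , d<e , least) → there d∈ , there e∈ , d<e , λ where
      -- The entry d comes from the tail, so it exceeds the head x.
      (here refl) d<x → contradiction (<-≤-trans x<y (head-least sorted d∈)) (<-asym d<x)
      (there z∈)  d<z → least z∈ d<z)
    (successors-least sorted)

-- A discrete intermediate value principle. With P divisibility by p, it finds the step where a
-- chain of divisors first picks up the factor p.
crossing : ∀ {x xs} → Decidable P → Linked R (x ∷ xs) → ¬ P x → Any P (x ∷ xs) →
  ∃₂ λ d e → d ∈ˡ x ∷ xs × e ∈ˡ x ∷ xs × R d e × ¬ P d × P e
crossing P? _ ¬px (here px) = contradiction px ¬px
crossing P? (_∷_ {y = y} Rxy Rxs) ¬px (there any) with P? y
... | yes py = _ , _ , here refl , there (here refl) , Rxy , ¬px , py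
... | no ¬py =
  let d , e , d∈ , e∈ , rest = crossing P? Rxs ¬py any
  in d , e , there d∈ , there e∈ , rest

prime-divisor : ∀ n .{{_ : NonTrivial n}} → ∃[ p ] Prime p × p ∣ n
prime-divisor n = go (factors f) (isFactorisation f) (factorsPrime f)
  where
  open PrimeFactorisation
  f = factorise n {{ℕ.nonTrivial⇒nonZero n}}
  go : ∀ ps → n ≡ product ps → All Prime ps → ∃[ p ] Prime p × p ∣ n
  go []       n≡1 _             = contradiction n≡1 (ℕ.nonTrivial⇒≢1 {n})
  go (p ∷ ps) n≡  (pp All.∷ _) = p , pp , divides (product ps) (trans n≡ (*-comm p _))

∣-nonZero : ∀ {d n} .{{_ : NonZero n}} → d ∣ n → NonZero d
∣-nonZero {zero}  {n} 0∣n = contradiction (0∣⇒≡0 0∣n) (ℕ.≢-nonZero⁻¹ n)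
∣-nonZero {suc _} _   = _

-- Write n = q * d; by Euclid's lemma p must divide q.
prime*∣ : ∀ {p d n} → Prime p → p ∣ n → ¬ p ∣ d → d ∣ n → p * d ∣ n
prime*∣ {p} {d} pp p∣n p∤d (divides-refl q) with euclidsLemma q d pp p∣n
... | inj₁ p∣q = *-monoˡ-∣ d p∣q
... | inj₂ p∣d = contradiction p∣d p∤d

smooth-∣ : ∀ y {d n} → n ∈ Smooth y → d ∣ n → d ∈ Smooth y
smooth-∣ y (n≢0 , primes≤y) d∣n =
  ∣-nonZero {{n≢0}} d∣n , λ p pp p∣d → primes≤y p pp (∣-trans p∣d d∣n)

divisors : ℕ → List ℕ
divisors n = filter (_∣? n) (upTo (suc n))

divisors-sorted : ∀ n → Linked _<_ (divisors n)
divisors-sorted n = Linkedₚ.filter⁺ (_∣? n) <-trans (Linkedₚ.applyUpTo⁺₂ id (suc n) n<1+n)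

∈-divisors⁺ : ∀ {d n} .{{_ : NonZero n}} → d ∣ n → d ∈ˡ divisors n
∈-divisors⁺ {n = n} d∣n = ∈-filter⁺ (_∣? n) (∈-upTo⁺ (s≤s (∣⇒≤ d∣n))) d∣n

∈-divisors⁻ : ∀ n {d} → d ∈ˡ divisors n → d ∣ n
∈-divisors⁻ n = proj₂ ∘ ∈-filter⁻ (_∣? n) {xs = upTo (suc n)}

divisors-dense : ∀ y {n} → n ∈ Smooth y → Dense y (divisors n)
divisors-dense y {n} (n≢0 , primes≤y) = Linked.map ratio≤y (successors-least (divisors-sorted n))
  where
  instance _ = n≢0
  ratio≤y : ∀ {d e} → d ∈ˡ divisors n × e ∈ˡ divisors n × d < e ×
            (∀ {z} → z ∈ˡ divisors n → d < z → e ℕ.≤ z) →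
            .{{_ : NonZero d}} → fromℚ (+ e / d) ≤ y
  ratio≤y {d} {e} (d∈ , e∈ , d<e , least) =
    ≤-fromℚ-≤ y (*≤*⇒/≤/ e d p 1 (subst (ℕ._≤ p * d) (sym (*-identityʳ e)) e≤pd)) (primes≤y p pp p∣n)
    where
    d∣n = ∈-divisors⁻ n d∈
    d<n = <-≤-trans d<e (∣⇒≤ (∈-divisors⁻ n e∈))
    -- Here n / d > 1 because d < n, and any prime p dividing n / d makes p * d a divisor of n.
    prime = prime-divisor (quotient d∣n) {{n>1⇒nonTrivial (quotient>1 d∣n d<n)}}
    p = proj₁ prime
    pp = proj₁ (proj₂ prime)
    p∣q = proj₂ (proj₂ prime)
    p∣n = ∣-trans p∣q (quotient-∣ d∣n)
    pd∣n : p * d ∣ n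
    pd∣n = subst (p * d ∣_) (sym (m∣n⇒n≡quotient*m d∣n)) (*-monoˡ-∣ d p∣q)
    e≤pd : e ℕ.≤ p * d
    -- As p > 1, the divisor p * d lies above d, and e is the least divisor that does.
    e≤pd = least (∈-divisors⁺ pd∣n)
      (subst (d <_) (*-comm d p) (m<m*n d p (ℕ.nonTrivial⇒n>1 p {{prime⇒nonTrivial pp}})))

-- The set A is left general to serve the stages of both hierarchies, once every divisor of n is
-- known to take part.
smooth⇒denseFrom1To : ∀ y {n A} → n ∈ Smooth y → (∀ d → d ∣ n ⇔ d ∈ A) → DenseFrom1To n y A
smooth⇒denseFrom1To y {n} smooth@(n≢0 , _) ∣n⇔A =
  divisors n , divisors-sorted n ,
  (λ d → mk⇔ (Equivalence.to (∣n⇔A d) ∘ ∈-divisors⁻ n) (∈-divisors⁺ ∘ Equivalence.from (∣n⇔A d))) ,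
  divisors-dense y smooth , ∈-divisors⁺ (1∣ n) , ∈-divisors⁺ ∣-refl
  where instance _ = n≢0

-- The induction step for both hierarchies: the multiple of p at which the chain crosses exceeds k
-- and lies below n, so the bound grows by one. The rational r witnesses y < p.
denseFrom1To⇒multiples-grow : ∀ y {r p k n A} → Prime p → r ∈ ℝ.upper y → r ℚ.< (+ p / 1) →
  .{{_ : NonZero n}} → p ∣ n → (∀ {d} → d ∈ A → d ∣ n) → (∀ {d} → d ∈ A → p ∣ d → k < d) →
  DenseFrom1To n y A → suc k < n
denseFrom1To⇒multiples-grow y _ _ _ _ _ _ ([] , _ , _ , _ , () , _)
denseFrom1To⇒multiples-grow y {p = p} {n = n} pp r∈upper r<p p∣n A⊆∣n k<
  (x ∷ xs , sorted , ds⇔A , dense , 1∈ , n∈)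
  with crossing (p ∣?_) dense p∤x (lose n∈ p∣n)
  where
  p∤x : ¬ p ∣ x
  -- The head is nonzero and at most the entry 1, hence smaller than p.
  p∤x p∣x = <⇒≱ (ℕ.nonTrivial⇒n>1 p {{prime⇒nonTrivial pp}})
    (≤-trans (∣⇒≤ {{∣-nonZero (A⊆∣n (Equivalence.to (ds⇔A x) (here refl)))}} p∣x)
             (head-least sorted 1∈))
... | d , e , d∈ , e∈ , e/d≤y , p∤d , p∣e =
  <-≤-trans (≤-<-trans (k< (member e∈) p∣e) e<pd) (∣⇒≤ (prime*∣ pp p∣n p∤d (A⊆∣n (member d∈))))
  where
  member : ∀ {z} → z ∈ˡ x ∷ xs → _
  member {z} = Equivalence.to (ds⇔A z)
  instance _ = ∣-nonZero (A⊆∣n (member d∈))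
  e<pd : e < p * d
  -- Otherwise r < p ≤ e / d ≤ r.
  e<pd = ≰⇒> λ pd≤e → ℚₚ.<-irrefl refl (ℚₚ.<-≤-trans r<p (ℚₚ.≤-trans
    (*≤*⇒/≤/ p 1 e d (subst (p * d ℕ.≤_) (sym (*-identityʳ e)) pd≤e))
    (≤⇒≤upper y e/d≤y r∈upper)))

unbounded⇒smooth : ∀ y {n} (B : ℕ → Pred ℕ 0ℓ) → NonZero n →
  (∀ {p r} → Prime p → r ∈ ℝ.upper y → r ℚ.< (+ p / 1) → ∀ i {m} → p ∣ m → m ∈ B i → i < m) →
  n ∈ ⋂ ℕ B → n ∈ Smooth y
unbounded⇒smooth y {n} B n≢0 grow n∈B =
  n≢0 , λ p pp p∣n → ≤-via-upper y (+ p / 1) λ r∈upper r<p →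
    -- Stage n itself is already absurd for a multiple n of p: it would give n < n.
    <-irrefl refl (grow pp r∈upper r<p n p∣n (n∈B n))

smooth⇒D : ∀ y i {n} → n ∈ Smooth y → n ∈ D y i
smooth⇒D y zero    (n≢0 , _) = n≢0
smooth⇒D y (suc i) smooth@(n≢0 , _) =
  n≢0 , smooth⇒denseFrom1To y smooth λ d →
    mk⇔ (λ d∣n → d∣n , smooth⇒D y i (smooth-∣ y smooth d∣n)) proj₁

D-multiples-grow : ∀ y {p r} → Prime p → r ∈ ℝ.upper y → r ℚ.< (+ p / 1) →
                   ∀ i {n} → p ∣ n → n ∈ D y i → i < n
D-multiples-grow y _ _ _ zero _ n≢0 = ℕ.>-nonZero⁻¹ _ {{n≢0}}
D-multiples-grow y pp r∈upper r<p (suc i) p∣n (n≢0 , dense) =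
  denseFrom1To⇒multiples-grow y pp r∈upper r<p {{n≢0}} p∣n proj₁
    (λ (_ , d∈D) p∣d → D-multiples-grow y pp r∈upper r<p i p∣d d∈D) dense

D⇒smooth : ∀ y → ⋂ ℕ (D y) ⊆ Smooth y
D⇒smooth y n∈D = unbounded⇒smooth y (D y) (n∈D 0) (D-multiples-grow y) n∈D

-- The stages occurring inside D* y i carry accessibility proofs other than
-- <-wellFounded, so the inductions range over all of them; D* y i is
-- definitionally D*-acc y i (<-wellFounded i).
D*-acc : ℝ → ∀ i → Acc _<_ i → Pred ℕ 0ℓ
D*-acc y i a = D*-step y i (Some.wfRecBuilder (λ _ → Pred ℕ 0ℓ) (D*-step y) i a)

smooth⇒D*-acc : ∀ y i (a : Acc _<_ i) {n} → n ∈ Smooth y → n ∈ D*-acc y i a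
smooth⇒D*-acc y zero    _        (n≢0 , _) = n≢0
smooth⇒D*-acc y (suc i) (acc rs) smooth@(n≢0 , _) =
  n≢0 , λ j j≤i → smooth⇒denseFrom1To y smooth λ d →
    -- Both d and n / d divide n, so both are smooth and lie in the earlier stages j and i ∸ j.
    mk⇔ (λ d∣n → d∣n , smooth⇒D*-acc y j (rs (s≤s j≤i)) (smooth-∣ y smooth d∣n) ,
                 smooth⇒D*-acc y (i ∸ j) (rs (s≤s (m∸n≤m i j))) (smooth-∣ y smooth (quotient-∣ d∣n)))
        proj₁

D*-acc-multiples-grow : ∀ y {p r} → Prime p → r ∈ ℝ.upper y → r ℚ.< (+ p / 1) →
                        ∀ i (a : Acc _<_ i) {n} → p ∣ n → n ∈ D*-acc y i a → i < n
D*-acc-multiples-grow y _ _ _ zero _ _ n≢0 = ℕ.>-nonZero⁻¹ _ {{n≢0}}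
D*-acc-multiples-grow y pp r∈upper r<p (suc i) (acc rs) p∣n (n≢0 , dense) =
  denseFrom1To⇒multiples-grow y pp r∈upper r<p {{n≢0}} p∣n proj₁
    (λ (_ , d∈D* , _) p∣d → D*-acc-multiples-grow y pp r∈upper r<p i (rs _) p∣d d∈D*)
    -- The choice j = i gives a chain of members of stage i, where the induction hypothesis applies.
    (dense i ≤-refl)

smooth⇒D* : ∀ y i {n} → n ∈ Smooth y → n ∈ D* y i
smooth⇒D* y i = smooth⇒D*-acc y i (<-wellFounded i)

D*⇒smooth : ∀ y → ⋂ ℕ (D* y) ⊆ Smooth y
D*⇒smooth y n∈D* = unbounded⇒smooth y (D* y) (n∈D* 0)
  (λ pp r∈upper r<p i → D*-acc-multiples-grow y pp r∈upper r<p i (<-wellFounded i)) n∈D*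

corollary1 : (y : ℝ) → fromℕ 2 ≤ y →
    (Smooth y ≐ ⋂ ℕ (λ i → D y i)) × (⋂ ℕ (λ i → D y i) ≐ ⋂ ℕ (λ i → D* y i))
corollary1 y _ =
  ((λ smooth i → smooth⇒D y i smooth) , D⇒smooth y) ,
  -- Both inclusions pass through `Smooth y`.
  ((λ n∈D i → smooth⇒D* y i (D⇒smooth y n∈D)) , (λ n∈D* i → smooth⇒D y i (D*⇒smooth y n∈D*)))
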